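{- There exists a planar graph $G$ with $\chi_2(G)=20$.
   Context: A signified graph $(G,\Sigma)$ is a simple graph $G$ with a set $\Sigma\subseteq E(G)$ of negative edges, other edges positive. A signified homomorphism of $(G,\Sigma)$ to $(H,\Lambda)$ is a map $V(G)\to V(H)$ sending every edge to an edge of the same sign. $\chi_2(G,\Sigma)$ is the minimum number of vertices of a signified graph to which $(G,\Sigma)$ admits a signified homomorphism, and $\chi_2(G)=\max_{\Sigma\subseteq E(G)}\chi_2(G,\Sigma)$. -}

module Defs where

open import Data.Bool using (Bool; true; false; T)
open import Data.Fin using (Fin; _<_)
open import Data.List using (List; []; _∷_; [_]; _++_)
open import Data.List.Relation.Unary.Any using (Any)
open import Data.Nat using (ℕ; _≤_)
open import Data.Product using (Σ-syntax; ∃; ∃-syntax; _×_; _,_)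
open import Data.Rational as ℚ using (ℚ; 0ℚ; 1ℚ)
open import Data.Sum using (_⊎_)
open import Data.Unit using (⊤)
open import Relation.Binary.PropositionalEquality using (_≡_; _≢_)

record SimpleGraph (n : ℕ) : Set where
  field
    adj    : Fin n → Fin n → Bool
    sym    : ∀ u v → adj u v ≡ adj v u
    irrefl : ∀ v → adj v v ≡ false

  -- The endpoints of an undirected edge are listed in increasing order, so
  -- every edge is represented exactly once.
  record Edge : Set where
    constructor edge
    field
      src tgt  : Fin n
      src<tgt  : src < tgt
      adjacent : T (adj src tgt)

-- A subset of E(G), as a symmetric relation contained in adjacency.
record EdgeSet {n : ℕ} (G : SimpleGraph n) : Set where
  open SimpleGraph G using (adj)
  field
    mem    : Fin n → Fin n → Bool
    sym    : ∀ u v → mem u v ≡ mem v u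
    subset : ∀ u v → T (mem u v) → T (adj u v)

record SignifiedGraph (n : ℕ) : Set where
  constructor _,ₛ_
  field
    graph    : SimpleGraph n
    negative : EdgeSet graph

  open SimpleGraph graph public using (adj)
  open EdgeSet negative public using () renaming (mem to neg)

record SignifiedHom {m n : ℕ} (G : SignifiedGraph m) (H : SignifiedGraph n) : Set where
  private
    module G = SignifiedGraph G
    module H = SignifiedGraph H
  field
    map       : Fin m → Fin n
    edge-pres : ∀ u v → T (G.adj u v) → T (H.adj (map u) (map v))
    sign-pres : ∀ u v → T (G.adj u v) → H.neg (map u) (map v) ≡ G.neg u v

IsMinimum IsMaximum : (ℕ → Set) → ℕ → Set
IsMinimum P k = P k × (∀ m → P m → k ≤ m)
IsMaximum P k = P k × (∀ m → P m → m ≤ k)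

-- χ₂(G,Σ) ≡ k and χ₂(G) ≡ k, as relations between the graph and k.
SignifiedChromaticNumber : ∀ {n} → SignifiedGraph n → ℕ → Set
SignifiedChromaticNumber G =
  IsMinimum (λ m → Σ[ H ∈ SignifiedGraph m ] SignifiedHom G H)

χ₂[_]≡_ : ∀ {n} → SimpleGraph n → ℕ → Set
χ₂[ G ]≡ k =
  IsMaximum (λ m → Σ[ S ∈ EdgeSet G ] SignifiedChromaticNumber (G ,ₛ S) m) k

-- Planarity is the existence of a drawing in the plane in which vertices are
-- distinct points and edges are polygonal arcs.  Coordinates are rational.
-- Nothing is lost compared with the real plane: segments with rational ends
-- that meet in ℝ² also meet in ℚ², with the same intersection up to closure,
-- and a finite graph that can be drawn in ℝ² can be drawn with such arcs.

Point : Set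
Point = ℚ × ℚ

OnSegment : Point → Point → Point → Set
OnSegment (a₁ , a₂) (b₁ , b₂) x =
  ∃[ t ] (0ℚ ℚ.≤ t × t ℚ.≤ 1ℚ ×
          x ≡ (a₁ ℚ.+ t ℚ.* (b₁ ℚ.- a₁) , a₂ ℚ.+ t ℚ.* (b₂ ℚ.- a₂)))

segments : List Point → List (Point × Point)
segments []           = []
segments (p ∷ [])     = []
segments (p ∷ q ∷ ps) = (p , q) ∷ segments (q ∷ ps)

OnPolyline : List Point → Point → Set
OnPolyline ps x = Any (λ (p , q) → OnSegment p q x) (segments ps)

-- The polyline is an arc, i.e. it does not touch or cross itself: each segment
-- meets the remainder of the line only in the corner they share.
SimplePolyline : List Point → Set
SimplePolyline []           = ⊤
SimplePolyline (p ∷ [])     = ⊤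
SimplePolyline (p ∷ q ∷ ps) =
  p ≢ q ×
  (∀ x → OnSegment p q x → OnPolyline (q ∷ ps) x → x ≡ q) ×
  SimplePolyline (q ∷ ps)

record PlaneDrawing {n : ℕ} (G : SimpleGraph n) : Set where
  open SimpleGraph G
  open Edge
  field
    pos   : Fin n → Point
    bends : Edge → List Point

  arc : Edge → List Point
  arc e = pos (src e) ∷ bends e ++ [ pos (tgt e) ]

  field
    pos-injective : ∀ u v → pos u ≡ pos v → u ≡ v
    arc-simple    : ∀ e → SimplePolyline (arc e)
    vertex-on-arc : ∀ e v → OnPolyline (arc e) (pos v) → v ≡ src e ⊎ v ≡ tgt e
    -- With vertex-on-arc, the vertex v is a common endpoint of e and f.
    arcs-meet     : ∀ e f → e ≢ f → ∀ x →
                    OnPolyline (arc e) x → OnPolyline (arc f) x →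
                    ∃[ v ] x ≡ pos v

Planar : ∀ {n} → SimpleGraph n → Set
Planar G = PlaneDrawing G

{-# OPTIONS --safe #-}

-- Stacked triangulations, in which vertices are repeatedly put into triangular
-- faces, are drawn with straight edges by putting each new vertex at the
-- centroid: in barycentric coordinates the three subtriangles are given by which
-- coordinate is the smallest one.
--
-- Upper bound: the double cover of the Paley graph on 𝔽₉ with an apex has 20
-- vertices, and each of its triangles has a common neighbour with any three
-- prescribed signs; so a stacked triangulation is coloured vertex by vertex.
--
-- Lower bound: an alternating path on five vertices needs 4 colours.  A vertex
-- joined positively to one such path and negatively to another one needs
-- 4 + 4 + 1 = 9, and the same step applied to these gives 9 + 9 + 1 = 19.  If
-- every vertex of that graph in turn has 9 positive and 9 negative neighbouring
-- colours, then 19 colours would carry a 9-regular graph, but 19 · 9 is odd.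
module Submission where

open import Defs
open import Data.Bool using (Bool; true; false; T; not; _∧_; _∨_; _xor_; if_then_else_) renaming (_≟_ to _≟ᴮ_)
open import Data.Bool.Properties using (T?; T-irrelevant; xor-comm)
open import Data.Bool.Solver using () renaming (module xor-∧-Solver to 𝔽₂-Solver)
open import Data.Fin as Fin using (Fin; zero; suc; _≟_; splitAt; _↑ˡ_; _↑ʳ_; remQuot)
open import Data.Fin.Patterns
import Data.Fin.Properties as Fin
open import Data.Fin.Properties using (all?; any?; splitAt-↑ˡ; splitAt-↑ʳ; 1↔⊤; +↔⊎)
import Data.Integer as ℤ
open import Data.List using (List; []; _∷_; _++_; length; filter; allFin; tabulate)
open import Data.List.Membership.DecPropositional using (_∈?_)
open import Data.List.Membership.Propositional using (_∈_)
open import Data.List.Membership.Propositional.Properties using (∈-∃++; ∈-++⁺ˡ; ∈-++⁺ʳ; ∈-++⁻; ∈-allFin; ∈-filter⁺; ∈-filter⁻)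
open import Data.List.Properties using (length-++; length-tabulate)
open import Data.List.Relation.Binary.Disjoint.Propositional using (Disjoint)
open import Data.List.Relation.Binary.Subset.Propositional using (_⊆_)
open import Data.List.Relation.Unary.All as All using (All; []; _∷_)
import Data.List.Relation.Unary.All.Properties as All
open import Data.List.Relation.Unary.AllPairs using ([]; _∷_)
open import Data.List.Relation.Unary.Any using (here; there)
open import Data.List.Relation.Unary.Unique.Propositional using (Unique)
import Data.List.Relation.Unary.Unique.Propositional.Properties as Unique
open import Data.Maybe using (Maybe; just; nothing; is-just; fromMaybe)
open import Data.Nat as ℕ using (ℕ; zero; suc; z≤n; s≤s)
open import Data.Nat.Divisibility using (_∣_; _∣?_; divides)
import Data.Nat.Properties as ℕ
open import Data.Nat.Solver using () renaming (module +-*-Solver to ℕ-Solver)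
open import Data.Product using (Σ-syntax; ∃; ∃-syntax; _×_; _,_; proj₁; proj₂)
open import Data.Rational using (ℚ; 0ℚ; 1ℚ; _+_; _*_; _-_; -_; _/_; _<_; _≤_; _<?_; positive; nonNegative)
import Data.Rational.Properties as ℚ
open import Data.Rational.Solver using () renaming (module +-*-Solver to ℚ-Solver)
open import Data.Sum as Sum using (_⊎_; inj₁; inj₂; [_,_]′)
open import Data.Sum.Function.Propositional using (_⊎-↔_)
open import Data.Unit using (⊤; tt)
open import Data.Vec.Functional as Vec using ()
open import Function using (_∘_; id; const; _↔_; mk↔ₛ′; Inverse)
open import Function.Construct.Composition using (_↔-∘_)
open import Function.Construct.Identity using (↔-id)
open import Relation.Binary.PropositionalEquality
open import Relation.Nullary using (Dec; yes; no; does; contradiction; ¬_; ¬?; _×-dec_; _→-dec_; toWitness; toWitnessFalse)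
open import Relation.Nullary.Decidable using (dec-true; dec-false)

open import Algebra.Properties.CommutativeMonoid.Sum ℕ.+-0-commutativeMonoid using (sum; sum-cong-≗; ∑-distrib-+)

-- Signed stacked triangulations

Sign : Set
Sign = Bool

pattern pos = false
pattern neg = true

-- A stacked triangulation of a triangle: `node σ sub` puts a new vertex in the
-- triangle, joined to corner i with sign σ i, and stacks sub k in the
-- triangle obtained by replacing corner k by the new vertex.  The three corners
-- are vertices too, but are not joined to each other.
data Tree : Set where
  leaf : Tree
  node : (Fin 3 → Sign) → (Fin 3 → Tree) → Tree

data Pos : Tree → Set where
  here : ∀ {σ sub} → Pos (node σ sub)
  go   : ∀ {σ sub} k → Pos (sub k) → Pos (node σ sub)

infixl 6 _[_]≔_

_[_]≔_ : ∀ {a} {A : Set a} → (Fin 3 → A) → Fin 3 → A → Fin 3 → A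
(c [ k ]≔ w) i = if does (i ≟ k) then w else c i

-- In subtriangle `k` the corner `k` is the new vertex, so a link to it is no link to the outer
-- corner `k`, and that entry is erased.
toCorner : ∀ {t} → Pos t → Fin 3 → Maybe Sign
toCorner (here {σ}) i = just (σ i)
toCorner (go k p)     = toCorner p [ k ]≔ nothing

-- The vertex `here` is corner `k` of subtriangle `k`, so its links into that part are read off
-- `toCorner`. Vertices stacked in different subtriangles are never joined.
between : ∀ {t} → Pos t → Pos t → Maybe Sign
between here     here     = nothing
between here     (go k q) = toCorner q k
between (go k p) here     = toCorner p k
between (go k p) (go l q) with k ≟ l
... | yes refl = between p q
... | no  _    = nothing

between-go : ∀ {σ sub} k (p q : Pos (sub k)) →
             between (go {σ} {sub} k p) (go k q) ≡ between p q
between-go k p q with k ≟ k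
... | yes refl = refl
... | no  k≢k  = contradiction refl k≢k

module _ {m} (H : SignifiedGraph m) where
  open SignifiedGraph H using () renaming (adj to adjᴴ; neg to negᴴ)

  record HasSign (s : Sign) (x y : Fin m) : Set where
    constructor _,_
    field
      adjacent : T (adjᴴ x y)
      sign     : negᴴ x y ≡ s

module _ {m} {H : SignifiedGraph m} where
  open SignifiedGraph H using (graph; negative)

  HasSign-sym : ∀ {s x y} → HasSign H s x y → HasSign H s y x
  HasSign-sym (a , n) =
    subst T (SimpleGraph.sym graph _ _) a , trans (EdgeSet.sym negative _ _) n

  HasSign-irrefl : ∀ {s x} → ¬ HasSign H s x x
  HasSign-irrefl {x = x} (a , _) = subst T (SimpleGraph.irrefl graph x) a

  HasSign⇒≢ : ∀ {s x y} → HasSign H s x y → x ≢ y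
  HasSign⇒≢ a refl = HasSign-irrefl a

  HasSign-unique : ∀ {s s′ x y} → HasSign H s x y → HasSign H s′ x y → s ≡ s′
  HasSign-unique (_ , n) (_ , n′) = trans (sym n) n′

  opposite⇒≢ : ∀ {x y v} → HasSign H pos x v → HasSign H neg y v → x ≢ y
  opposite⇒≢ a b refl with () ← HasSign-unique a b

-- Colours forced at corner 0

module _ {m} (H : SignifiedGraph m) where

  record Realises (t : Tree) (c : Fin 3 → Fin m) (g : Pos t → Fin m) : Set where
    field
      corner : ∀ p i {s} → toCorner p i ≡ just s → HasSign H s (g p) (c i)
      inner  : ∀ p q {s} → between p q ≡ just s → HasSign H s (g p) (g q)

  open Realises

  realises-sub : ∀ {σ sub c g} → Realises (node σ sub) c g →
                 ∀ k → Realises (sub k) (c [ k ]≔ g here) (g ∘ go k)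
  realises-sub r k .corner p i e with i ≟ k | corner r (go k p) i
  ... | yes refl | _ = inner r (go k p) here e
  ... | no  _    | f = f e
  realises-sub {σ} r k .inner p q e = inner r (go k p) (go k q) (trans (between-go {σ} k p q) e)

  -- Gadgets are hung on corner 0: `Q` must hold there whatever the colours of the other two
  -- corners.
  Forces : Tree → (Fin m → Set) → Set
  Forces t Q = ∀ {c g} → Realises t c g → Q (c 0F)

  Distinct : ℕ → (Fin m → Set) → Set
  Distinct k Q = Σ[ xs ∈ List (Fin m) ] (length xs ≡ k × Unique xs × All Q xs)

  Distinct-⊆ : ∀ {k} {P Q : Fin m → Set} → (∀ {x} → P x → Q x) → Distinct k P → Distinct k Q
  Distinct-⊆ f (xs , len , u , ps) = xs , len , u , All.map f ps

  Coloured : Fin m → (Fin m → Set) → Sign → Fin m → Set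
  Coloured v Q s x = HasSign H s x v × Q x

  -- A colour joined positively to `v` differs from one joined negatively, as an edge has one sign,
  -- and neither is `v`, as there are no loops.
  cone : ∀ {a b v Q} → Q v → Distinct a (Coloured v Q pos) → Distinct b (Coloured v Q neg) →
         Distinct (suc (a ℕ.+ b)) Q
  cone {v = v} {Q} qv (xs , refl , uxs , pxs) (ys , refl , uys , pys) =
    v ∷ xs ++ ys ,
    cong suc (length-++ xs) ,
    All.++⁺ (All.map (v≢ {Q = Q}) pxs) (All.map (v≢ {Q = Q}) pys) ∷ Unique.++⁺ uxs uys disjoint ,
    qv ∷ All.++⁺ (All.map proj₂ pxs) (All.map proj₂ pys)
    where
    v≢ : ∀ {s x} {Q : Fin m → Set} → Coloured v Q s x → v ≢ x
    v≢ (h , _) e = HasSign⇒≢ h (sym e)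
    disjoint : Disjoint xs ys
    disjoint (x∈xs , x∈ys) =
      opposite⇒≢ (proj₁ (All.lookup pxs x∈xs)) (proj₁ (All.lookup pys x∈ys)) refl

  -- If the fourth vertex repeats the colour of the first, then the fifth
  -- cannot have the colour of the second.
  alternating-path : ∀ {Q : Fin m → Set} {x₀ x₁ x₂ x₃ x₄} →
    HasSign H pos x₁ x₀ → HasSign H neg x₂ x₁ → HasSign H pos x₃ x₂ → HasSign H neg x₄ x₃ →
    All Q (x₀ ∷ x₁ ∷ x₂ ∷ x₃ ∷ x₄ ∷ []) → Distinct 4 Q
  alternating-path {x₀ = x₀} {x₁} {x₂} {x₃} {x₄} e₁ e₂ e₃ e₄ (q₀ ∷ q₁ ∷ q₂ ∷ q₃ ∷ q₄ ∷ [])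
    with x₃ ≟ x₀
  ... | no x₃≢x₀ =
    x₀ ∷ x₁ ∷ x₂ ∷ x₃ ∷ [] , refl ,
    (x₀≢x₁ ∷ x₀≢x₂ ∷ (x₃≢x₀ ∘ sym) ∷ []) ∷ (x₁≢x₂ ∷ x₁≢x₃ ∷ []) ∷ (x₂≢x₃ ∷ []) ∷ [] ∷ [] ,
    q₀ ∷ q₁ ∷ q₂ ∷ q₃ ∷ []
    where
    x₀≢x₁ = HasSign⇒≢ (HasSign-sym e₁)
    x₀≢x₂ = opposite⇒≢ (HasSign-sym e₁) e₂
    x₁≢x₂ = HasSign⇒≢ (HasSign-sym e₂)
    x₁≢x₃ = opposite⇒≢ e₃ (HasSign-sym e₂) ∘ sym
    x₂≢x₃ = HasSign⇒≢ (HasSign-sym e₃)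
  ... | yes refl =
    x₀ ∷ x₁ ∷ x₂ ∷ x₄ ∷ [] , refl ,
    (x₀≢x₁ ∷ x₀≢x₂ ∷ x₀≢x₄ ∷ []) ∷ (x₁≢x₂ ∷ x₁≢x₄ ∷ []) ∷ (x₂≢x₄ ∷ []) ∷ [] ∷ [] ,
    q₀ ∷ q₁ ∷ q₂ ∷ q₄ ∷ []
    where
    x₀≢x₁ = HasSign⇒≢ (HasSign-sym e₁)
    x₀≢x₂ = opposite⇒≢ (HasSign-sym e₁) e₂
    x₁≢x₂ = HasSign⇒≢ (HasSign-sym e₂)
    x₀≢x₄ = HasSign⇒≢ (HasSign-sym e₄)
    x₁≢x₄ = opposite⇒≢ e₁ e₄
    x₂≢x₄ = opposite⇒≢ (HasSign-sym e₃) e₄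

-- In a chain every new vertex is joined to the fixed corners 0 and 2 and to
-- its predecessor, which is corner 1.  K is stacked where the new vertex is
-- corner 0, so a property that K forces of corner 0 holds for all new vertices.
chain : Tree → Sign → List (Sign × Sign) → Tree
chain K s []             = leaf
chain K s ((r , y) ∷ ps) =
  node (s Vec.∷ r Vec.∷ y Vec.∷ Vec.[]) (K Vec.∷ chain K s ps Vec.∷ leaf Vec.∷ Vec.[])

-- A pair holds the signs towards the predecessor and towards corner 2. The first `pos` attaches the
-- path to whatever precedes it; the other four signs alternate along its edges.
steps : Sign → List (Sign × Sign)
steps y = (pos , y) ∷ (pos , y) ∷ (neg , y) ∷ (pos , y) ∷ (neg , y) ∷ []

-- Corner 0 is joined with sign s to a vertex x and to two alternating paths,
-- whose vertices are joined to x positively and negatively.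
fan : Tree → Sign → Tree → Tree
fan K s next =
  node (s Vec.∷ pos Vec.∷ pos Vec.∷ Vec.[])
       (K Vec.∷ next Vec.∷ chain K s (steps pos ++ steps neg) Vec.∷ Vec.[])

-- In the slot `next` corner 0 is still the same vertex, so the positive and the negative fan hang
-- on one vertex.
full : Tree → Tree
full K = fan K pos (fan K neg leaf)

module _ {m} (H : SignifiedGraph m) where
  open Realises

  Chained : (Fin m → Set) → Fin m → Fin m → Sign → Fin m → List (Sign × Sign) → Set
  Chained Q v x s prev []             = ⊤
  Chained Q v x s prev ((r , y) ∷ ps) =
    Σ[ w ∈ Fin m ] (HasSign H s w v × HasSign H r w prev × HasSign H y w x × Q w ×
                    Chained Q v x s w ps)

  chain-chained : ∀ {K s c Q} → Forces H K Q → ∀ ps {g} → Realises H (chain K s ps) c g →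
                  Chained Q (c 0F) (c 2F) s (c 1F) ps
  chain-chained K-forces []       r = tt
  chain-chained K-forces (_ ∷ ps) r =
    _ , corner r here 0F refl , corner r here 1F refl , corner r here 2F refl ,
    K-forces (realises-sub H r 0F) ,
    chain-chained K-forces ps (realises-sub H r 1F)

  -- Here 9 = 1 + 4 + 4: the vertex `x` of the fan, four colours from the path joined positively to
  -- `x`, and four from the other path. A copy of `K` hung on each of these vertices gives `Q`.
  fan-forces : ∀ {K s next Q} → Forces H K Q →
               Forces H (fan K s next) (λ v → Distinct H 9 (Coloured H v Q s))
  fan-forces K-forces r
    -- The two skipped edges attach the paths: `p₀` to corner 1, and `q₀` to `p₄`.
    with p₀ , a₀ , _  , b₀ , k₀ , p₁ , a₁ , e₁ , b₁ , k₁ , p₂ , a₂ , e₂ , b₂ , k₂ ,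
         p₃ , a₃ , e₃ , b₃ , k₃ , p₄ , a₄ , e₄ , b₄ , k₄ ,
         q₀ , c₀ , _  , d₀ , l₀ , q₁ , c₁ , f₁ , d₁ , l₁ , q₂ , c₂ , f₂ , d₂ , l₂ ,
         q₃ , c₃ , f₃ , d₃ , l₃ , q₄ , c₄ , f₄ , d₄ , l₄ , _
         ← chain-chained K-forces (steps pos ++ steps neg) (realises-sub H r 2F) =
    cone H (corner r here 0F refl , K-forces (realises-sub H r 0F))
      (alternating-path H e₁ e₂ e₃ e₄
        ((b₀ , a₀ , k₀) ∷ (b₁ , a₁ , k₁) ∷ (b₂ , a₂ , k₂) ∷ (b₃ , a₃ , k₃) ∷ (b₄ , a₄ , k₄) ∷ []))
      (alternating-path H f₁ f₂ f₃ f₄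
        ((d₀ , c₀ , l₀) ∷ (d₁ , c₁ , l₁) ∷ (d₂ , c₂ , l₂) ∷ (d₃ , c₃ , l₃) ∷ (d₄ , c₄ , l₄) ∷ []))

  Saturated : (Fin m → Set) → Fin m → Set
  Saturated Q v = ∀ s → Distinct H 9 (Coloured H v Q s)

  full-forces : ∀ {K Q} → Forces H K Q → Forces H (full K) (Saturated Q)
  full-forces K-forces r pos = fan-forces K-forces r
  full-forces K-forces r neg = fan-forces K-forces (realises-sub H r 1F)

-- Counting and parity

Unique-⊆⇒length≤ : ∀ {a} {A : Set a} {xs ys : List A} → Unique xs → xs ⊆ ys → length xs ℕ.≤ length ys
Unique-⊆⇒length≤ [] _ = z≤n
Unique-⊆⇒length≤ {xs = x ∷ xs} (x∉xs ∷ u) xs⊆ys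
  with as , bs , refl ← ∈-∃++ (xs⊆ys (here refl)) = begin
  suc (length xs)             ≤⟨ s≤s (Unique-⊆⇒length≤ u xs⊆as++bs) ⟩
  suc (length (as ++ bs))     ≡⟨ cong suc (length-++ as) ⟩
  suc (length as ℕ.+ length bs) ≡⟨ ℕ.+-suc (length as) (length bs) ⟨
  length as ℕ.+ suc (length bs) ≡⟨ length-++ as ⟨
  length (as ++ x ∷ bs)       ∎
  where
  open ℕ.≤-Reasoning
  xs⊆as++bs : xs ⊆ as ++ bs
  xs⊆as++bs y∈xs with ∈-++⁻ as (xs⊆ys (there y∈xs))
  ... | inj₁ y∈as         = ∈-++⁺ˡ y∈as
  ... | inj₂ (here refl)  = contradiction refl (All.lookup x∉xs y∈xs)
  ... | inj₂ (there y∈bs) = ∈-++⁺ʳ as y∈bs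

Unique-Fin⇒length≤ : ∀ {n} {xs : List (Fin n)} → Unique xs → length xs ℕ.≤ n
Unique-Fin⇒length≤ {n} {xs} u =
  subst (length xs ℕ.≤_) (length-tabulate id) (Unique-⊆⇒length≤ u (λ {x} _ → ∈-allFin x))

Unique-Fin⇒∈ : ∀ {n} {xs : List (Fin n)} → Unique xs → length xs ≡ n → ∀ x → x ∈ xs
Unique-Fin⇒∈ {n} {xs} u len x with _∈?_ _≟_ x xs
... | yes x∈xs = x∈xs
... | no  x∉xs = contradiction
  (subst (λ k → suc k ℕ.≤ n) len (Unique-Fin⇒length≤ (All.¬Any⇒All¬ xs x∉xs ∷ u))) ℕ.1+n≰n

indicator : Bool → ℕ
indicator b = if b then 1 else 0

length-filter : ∀ {n} {A : Set} (p : A → Bool) (f : Fin n → A) →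
                length (filter (T? ∘ p) (tabulate f)) ≡ sum (λ i → indicator (p (f i)))
length-filter {zero}  p f = refl
length-filter {suc n} p f with p (f 0F)
... | true  = cong suc (length-filter p (f ∘ suc))
... | false = length-filter p (f ∘ suc)

-- Deleting vertex 0 removes its row and its column, which have equal sums by symmetry, so the total
-- drops by an even amount.
handshake : ∀ {n} (f : Fin n → Fin n → ℕ) → (∀ i j → f i j ≡ f j i) → (∀ i → f i i ≡ 0) →
            ∃[ k ] sum (λ i → sum (f i)) ≡ k ℕ.+ k
handshake {zero}  f f-sym f-diag = 0 , refl
handshake {suc n} f f-sym f-diag
  with k , eq ← handshake (λ i j → f (suc i) (suc j)) (λ i j → f-sym _ _) (λ i → f-diag _) =
  row ℕ.+ k , (begin
    f 0F 0F ℕ.+ row ℕ.+ sum (λ i → f (suc i) 0F ℕ.+ sum (λ j → f (suc i) (suc j)))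
      ≡⟨ cong₂ (λ a b → a ℕ.+ row ℕ.+ b) (f-diag 0F)
           (∑-distrib-+ (λ i → f (suc i) 0F) (λ i → sum (λ j → f (suc i) (suc j)))) ⟩
    row ℕ.+ (sum (λ i → f (suc i) 0F) ℕ.+ sum (λ i → sum (λ j → f (suc i) (suc j))))
      ≡⟨ cong₂ (λ a b → row ℕ.+ (a ℕ.+ b)) (sum-cong-≗ (λ i → f-sym (suc i) 0F)) eq ⟩
    row ℕ.+ (row ℕ.+ (k ℕ.+ k))
      ≡⟨ solve 2 (λ r k → r :+ (r :+ (k :+ k)) := (r :+ k) :+ (r :+ k)) refl row k ⟩
    (row ℕ.+ k) ℕ.+ (row ℕ.+ k) ∎)
  where
  open ≡-Reasoning
  open ℕ-Solver
  row = sum (λ j → f 0F (suc j))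

sum-constant : ∀ {n d} {f : Fin n → ℕ} → (∀ i → f i ≡ d) → sum f ≡ n ℕ.* d
sum-constant {zero}  e = refl
sum-constant {suc n} e = cong₂ ℕ._+_ (e 0F) (sum-constant (e ∘ suc))

regular⇒even : ∀ {n d} (f : Fin n → Fin n → ℕ) → (∀ i j → f i j ≡ f j i) → (∀ i → f i i ≡ 0) →
               (∀ i → sum (f i) ≡ d) → 2 ∣ n ℕ.* d
regular⇒even {n} {d} f f-sym f-diag f-reg with k , eq ← handshake f f-sym f-diag = divides k (begin
  n ℕ.* d                  ≡⟨ sum-constant f-reg ⟨
  sum (λ i → sum (f i))  ≡⟨ eq ⟩
  k ℕ.+ k                  ≡⟨ cong (k ℕ.+_) (ℕ.+-identityʳ k) ⟨
  2 ℕ.* k                  ≡⟨ ℕ.*-comm 2 k ⟩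
  k ℕ.* 2                  ∎)
  where open ≡-Reasoning

module _ {m} (H : SignifiedGraph m) where
  open SignifiedGraph H using (graph; negative) renaming (adj to adjᴴ; neg to negᴴ)

  positiveEdge : Fin m → Fin m → Bool
  positiveEdge x y = adjᴴ x y ∧ not (negᴴ x y)

  positiveEdge⁺ : ∀ {x y} → HasSign H pos y x → T (positiveEdge x y)
  positiveEdge⁺ {x} {y} (a , n)
    rewrite SimpleGraph.sym graph x y | EdgeSet.sym negative x y | n with adjᴴ y x
  ... | true = tt

  positiveEdge⁻ : ∀ {x y} → T (positiveEdge x y) → HasSign H pos y x
  positiveEdge⁻ {x} {y} p with adjᴴ x y in a | negᴴ x y in n
  ... | true | false = HasSign-sym (subst T (sym a) tt , n)

  positives : Fin m → List (Fin m)
  positives v = filter (T? ∘ positiveEdge v) (allFin m)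

  -- Saturation gives at least nine positive neighbours. All of them, `v` itself and nine negative
  -- neighbours are distinct, so 10 plus their number is at most 19.
  saturated⇒positives : ∀ {Q} v → m ≡ 19 → Saturated H Q v → length (positives v) ≡ 9
  saturated⇒positives {Q} v refl sat
    with ps , 9≡ , ups , pps ← sat pos | ns , 9≡ns , uns , pns ← sat neg =
    ℕ.≤-antisym
      (ℕ.+-cancelʳ-≤ 10 _ _ (subst (ℕ._≤ 19) (ℕ.+-comm 10 _) bound))
      (subst (ℕ._≤ length (positives v)) 9≡ (Unique-⊆⇒length≤ ups ps⊆))
    where
    ps⊆ : ps ⊆ positives v
    ps⊆ x∈ps = ∈-filter⁺ (T? ∘ positiveEdge v) (∈-allFin _) (positiveEdge⁺ (proj₁ (All.lookup pps x∈ps)))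

    everything : Distinct H (1 ℕ.+ (length (positives v) ℕ.+ 9)) (const ⊤)
    everything = cone H {v = v} tt
      (positives v , refl , Unique.filter⁺ (T? ∘ positiveEdge v) (Unique.allFin⁺ m) ,
       All.tabulate (λ x∈ → positiveEdge⁻ (proj₂ (∈-filter⁻ (T? ∘ positiveEdge v) {xs = allFin m} x∈)) , tt))
      (ns , 9≡ns , uns , All.map (λ (h , _) → h , tt) pns)

    bound : 10 ℕ.+ length (positives v) ℕ.≤ 19
    bound with xs , len , u , _ ← everything =
      subst (ℕ._≤ 19) (trans len (cong suc (ℕ.+-comm _ 9))) (Unique-Fin⇒length≤ u)

  -- Otherwise the positive edges would form a 9-regular graph on 19 vertices.
  not-all-saturated : ∀ {Q} → m ≡ 19 → ¬ (∀ v → Saturated H Q v)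
  not-all-saturated m≡19 sat =
    -- 171 = 19 · 9 is the sum of the degrees.
    toWitnessFalse {a? = 2 ∣? 171} tt (subst (λ n → 2 ∣ n ℕ.* 9) m≡19 even)
    where
    even : 2 ∣ m ℕ.* 9
    even = regular⇒even (λ v x → indicator (positiveEdge v x))
      (λ v x → cong₂ (λ a n → indicator (a ∧ not n))
                 (SimpleGraph.sym graph v x) (EdgeSet.sym negative v x))
      (λ v → cong (λ a → indicator (a ∧ not (negᴴ v v))) (SimpleGraph.irrefl graph v))
      (λ v → trans (sym (length-filter (positiveEdge v) id)) (saturated⇒positives v m≡19 (sat v)))

  -- If `m` were 19, the given saturated vertices would be all the vertices, against parity.
  19-saturated⇒20≤ : ∀ {Q} → Distinct H 19 (Saturated H Q) → 20 ℕ.≤ m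
  19-saturated⇒20≤ (xs , 19≡ , u , sat) = ℕ.≤∧≢⇒<
    (subst (ℕ._≤ m) 19≡ (Unique-Fin⇒length≤ u))
    (λ 19≡m → not-all-saturated (sym 19≡m)
                (λ v → All.lookup sat (Unique-Fin⇒∈ u (trans 19≡ 19≡m) v)))

  saturating⇒20≤ : ∀ K → Forces H K (Saturated H (const ⊤)) →
                   ∀ {c g} → Realises H (full K) c g → 20 ℕ.≤ m
  saturating⇒20≤ K K-forces {c} {g} r = 19-saturated⇒20≤
    -- Corner 0 is itself saturated, as its saturated neighbours are in particular neighbours; this
    -- gives 1 + 9 + 9 = 19.
    (cone H (λ s → Distinct-⊆ H (λ (h , _) → h , tt) (outer s)) (outer pos) (outer neg))
    where
    outer : Saturated H (Saturated H (const ⊤)) (c 0F)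
    outer = full-forces H {K} K-forces {c} {g} r

  full-full⇒20≤ : ∀ {c g} → Realises H (full (full leaf)) c g → 20 ℕ.≤ m
  full-full⇒20≤ = saturating⇒20≤ (full leaf) (λ {c} {g} → full-forces H {leaf} (const tt) {c} {g})

-- The target on 20 vertices

-- The signed Paley graph on 𝔽₉ = 𝔽₃(i) together with a vertex 0F that is
-- positively joined to everything.  A difference is a square in 𝔽₉ iff
-- exactly one of its two coordinates is nonzero.
paley : Fin 10 → Fin 10 → Sign
paley 0F      _       = pos
paley (suc _) 0F      = pos
paley (suc x) (suc y) with remQuot {3} 3 x | remQuot {3} 3 y
... | a , b | a′ , b′ = not (does (a ≟ a′) ∨ does (b ≟ b′))

paley-sym : ∀ x y → paley x y ≡ paley y x
paley-sym = toWitness {a? = all? λ x → all? λ y → paley x y ≟ᴮ paley y x} tt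

-- Up to the choice of a sheet for the new vertex, only the product of two of the
-- three prescribed signs matters.
CommonNeighbour : Sign → Sign → Fin 10 → Fin 10 → Fin 10 → Fin 10 → Set
CommonNeighbour t₁ t₂ x y z b =
  b ≢ x × b ≢ y × b ≢ z × paley b y ≡ t₁ xor paley b x × paley b z ≡ t₂ xor paley b x

Extensible : Sign → Sign → Set
Extensible t₁ t₂ = ∀ x y → x ≢ y → ∀ z → x ≢ z → y ≢ z → ∃ (CommonNeighbour t₁ t₂ x y z)

extensible? : ∀ t₁ t₂ → Dec (Extensible t₁ t₂)
extensible? t₁ t₂ =
  all? λ x → all? λ y → ¬? (x ≟ y) →-dec
  all? λ z → ¬? (x ≟ z) →-dec (¬? (y ≟ z) →-dec
  any? λ b → ¬? (b ≟ x) ×-dec ¬? (b ≟ y) ×-dec ¬? (b ≟ z) ×-dec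
             (paley b y ≟ᴮ (t₁ xor paley b x)) ×-dec (paley b z ≟ᴮ (t₂ xor paley b x)))

extensible : ∀ t₁ t₂ → Extensible t₁ t₂
extensible pos pos = toWitness {a? = extensible? pos pos} tt
extensible pos neg = toWitness {a? = extensible? pos neg} tt
extensible neg pos = toWitness {a? = extensible? neg pos} tt
extensible neg neg = toWitness {a? = extensible? neg neg} tt

-- Colouring a stacked triangulation

module _ {n} (H : SignifiedGraph n) where
  open SignifiedGraph H using (graph) renaming (adj to adjᴴ)

  Clique : (Fin 3 → Fin n) → Set
  Clique c = ∀ i j → i ≢ j → T (adjᴴ (c i) (c j))

  Extends : Set
  Extends = ∀ c → Clique c → (s : Fin 3 → Sign) → ∃[ w ] (∀ i → HasSign H (s i) w (c i))

  Clique-[]≔ : ∀ {c} k {w} → Clique c → (∀ i → T (adjᴴ w (c i))) → Clique (c [ k ]≔ w)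
  Clique-[]≔ {c} k {w} clique w-adj i j i≢j with i ≟ k | j ≟ k
  ... | yes i≡k | yes j≡k = contradiction (trans i≡k (sym j≡k)) i≢j
  ... | yes _   | no  _   = w-adj j
  ... | no  _   | yes _   = subst T (SimpleGraph.sym graph w (c i)) (w-adj i)
  ... | no  _   | no  _   = clique i j i≢j

  -- The signs stored in the tree serve here only to tell which pairs are joined. The signs to be
  -- realised are `τC` and `τP`, because every set of negative edges has to be coloured.
  record Colours (t : Tree) (c : Fin 3 → Fin n) (τC : Pos t → Fin 3 → Sign) (τP : Pos t → Pos t → Sign)
                 (g : Pos t → Fin n) : Set where
    field
      corner : ∀ p i {s} → toCorner p i ≡ just s → HasSign H (τC p i) (g p) (c i)
      inner  : ∀ p q {s} → between p q ≡ just s → HasSign H (τP p q) (g p) (g q)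

  open Colours

  -- The colour of the new vertex comes from `extends`, and the three subtriangles are cliques
  -- again. The corner colours form a clique, although the graph does not join the corners, so that
  -- `extends` applies.
  colour : Extends → ∀ t c → Clique c → ∀ τC τP → (∀ p q → τP p q ≡ τP q p) → ∃ (Colours t c τC τP)
  colour extends leaf c clique τC τP τP-sym = (λ ()) , record { corner = λ () ; inner = λ () }
  colour extends (node σ sub) c clique τC τP τP-sym
    with w , w-sign ← extends c clique (τC here) = g , record { corner = g-corner ; inner = g-inner }
    where
    -- In subtriangle `k` the signs towards corner `k` are those towards the new vertex.
    sub-colour : ∀ k → ∃ (Colours (sub k) (c [ k ]≔ w) (λ p → τC (go k p) [ k ]≔ τP (go k p) here)
                                  (λ p q → τP (go k p) (go k q)))
    sub-colour k = colour extends (sub k) _ (Clique-[]≔ k clique (HasSign.adjacent ∘ w-sign)) _ _ (λ p q → τP-sym _ _)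

    g : Pos (node σ sub) → Fin n
    g here     = w
    g (go k p) = proj₁ (sub-colour k) p

    to-here : ∀ k p {s} → toCorner p k ≡ just s → HasSign H (τP (go k p) here) (g (go k p)) w
    to-here k p e with k ≟ k | corner (proj₂ (sub-colour k)) p k e
    ... | yes _   | h = h
    ... | no  k≢k | _ = contradiction refl k≢k

    g-corner : ∀ p i {s} → toCorner p i ≡ just s → HasSign H (τC p i) (g p) (c i)
    g-corner here     i _ = w-sign i
    g-corner (go k p) i e with i ≟ k | corner (proj₂ (sub-colour k)) p i
    ... | no _ | h = h e

    g-inner : ∀ p q {s} → between p q ≡ just s → HasSign H (τP p q) (g p) (g q)
    g-inner here     (go k q) e =
      subst (λ s → HasSign H s w (g (go k q))) (τP-sym (go k q) here) (HasSign-sym {y = w} (to-here k q e))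
    g-inner (go k p) here     e = to-here k p e
    g-inner (go k p) (go l q) e with k ≟ l
    ... | yes refl = inner (proj₂ (sub-colour k)) p q e


-- The double cover

base : Fin 20 → Fin 10
base u = [ id , id ]′ (splitAt 10 u)

sheet : Fin 20 → Bool
sheet u = [ const false , const true ]′ (splitAt 10 {10} u)

lift : Bool → Fin 10 → Fin 20
lift false b = b ↑ˡ 10
lift true  b = 10 ↑ʳ b

base-lift : ∀ a b → base (lift a b) ≡ b
base-lift false b = cong [ id , id ]′ (splitAt-↑ˡ 10 b 10)
base-lift true  b = cong [ id , id ]′ (splitAt-↑ʳ 10 10 b)

sheet-lift : ∀ a b → sheet (lift a b) ≡ a
sheet-lift false b = cong [ const false , const true ]′ (splitAt-↑ˡ 10 b 10)
sheet-lift true  b = cong [ const false , const true ]′ (splitAt-↑ʳ 10 10 b)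

coverAdj : Fin 20 → Fin 20 → Bool
coverAdj u v = not (does (base u ≟ base v))

-- Moving one end to the other sheet flips the sign, so each vertex of the base is present together
-- with its switched copy.
coverSign : Fin 20 → Fin 20 → Sign
coverSign u v = (sheet u xor sheet v) xor paley (base u) (base v)

≟-does-sym : ∀ {n} (x y : Fin n) → does (x ≟ y) ≡ does (y ≟ x)
≟-does-sym x y with x ≟ y
... | yes refl = sym (dec-true (x ≟ x) refl)
... | no  x≢y  = sym (dec-false (y ≟ x) (x≢y ∘ sym))

cover : SignifiedGraph 20
cover = record
  { adj    = coverAdj
  ; sym    = coverAdj-sym
  ; irrefl = λ v → cong not (dec-true (base v ≟ base v) refl)
  } ,ₛ record
  { mem    = λ u v → coverAdj u v ∧ coverSign u v
  ; sym    = λ u v → cong₂ _∧_ (coverAdj-sym u v)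
               (cong₂ _xor_ (xor-comm (sheet u) (sheet v)) (paley-sym (base u) (base v)))
  ; subset = λ u v → ∧⇒ˡ (coverAdj u v)
  }
  where
  coverAdj-sym : ∀ u v → coverAdj u v ≡ coverAdj v u
  coverAdj-sym u v = cong not (≟-does-sym (base u) (base v))
  ∧⇒ˡ : ∀ a {b} → T (a ∧ b) → T a
  ∧⇒ˡ true _ = tt

cover-hasSign : ∀ {s u v} → base u ≢ base v → coverSign u v ≡ s → HasSign cover s u v
cover-hasSign {u = u} {v} u≢v e =
  subst T (sym adj≡true) tt , trans (cong (_∧ coverSign u v) adj≡true) e
  where
  adj≡true : coverAdj u v ≡ true
  adj≡true = cong not (dec-false (base u ≟ base v) u≢v)

coverAdj⇒≢ : ∀ u v → T (coverAdj u v) → base u ≢ base v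
coverAdj⇒≢ u v a with base u ≟ base v
... | no u≢v = u≢v

lift-hasSign : ∀ a {s b v} → b ≢ base v → (a xor sheet v) xor paley b (base v) ≡ s →
               HasSign cover s (lift a b) v
lift-hasSign a {b = b} {v} b≢v e = cover-hasSign
  (subst (_≢ base v) (sym (base-lift a b)) b≢v)
  (trans (cong₂ (λ a b → (a xor sheet v) xor paley b (base v)) (sheet-lift a b) (base-lift a b)) e)

-- The base vertex `b` is chosen for the right products of signs, then its sheet for the right sign
-- towards corner 0; the products make the other two signs right.
cover-extends : Extends cover
cover-extends c clique s =
  let b , b≢0 , b≢1 , b≢2 , e₁ , e₂ =
        extensible (t 1F) (t 2F) (base (c 0F)) (base (c 1F)) (c≢ 0F 1F (λ ()))
          (base (c 2F)) (c≢ 0F 2F (λ ())) (c≢ 1F 2F (λ ()))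
  in lift (a b) b , λ
    { 0F → lift-hasSign (a b) b≢0 (cancel₀ (s 0F) (sheet (c 0F)) (paley b (base (c 0F))))
    ; 1F → lift-hasSign (a b) b≢1 (trans (cong ((a b xor sheet (c 1F)) xor_) e₁)
             (cancel (s 0F) (sheet (c 0F)) (s 1F) (sheet (c 1F)) (paley b (base (c 0F)))))
    ; 2F → lift-hasSign (a b) b≢2 (trans (cong ((a b xor sheet (c 2F)) xor_) e₂)
             (cancel (s 0F) (sheet (c 0F)) (s 2F) (sheet (c 2F)) (paley b (base (c 0F)))))
    }
  where
  open 𝔽₂-Solver
  c≢ : ∀ i j → i ≢ j → base (c i) ≢ base (c j)
  c≢ i j i≢j = coverAdj⇒≢ (c i) (c j) (clique i j i≢j)
  t : Fin 3 → Sign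
  -- This is the product of the signs wanted towards corners 0 and `i`, once the sheets of these
  -- corners are accounted for.
  t i = (s 0F xor sheet (c 0F)) xor (s i xor sheet (c i))
  a : Fin 10 → Bool
  a b = (s 0F xor sheet (c 0F)) xor paley b (base (c 0F))
  cancel₀ : ∀ s₀ a₀ p → (((s₀ xor a₀) xor p) xor a₀) xor p ≡ s₀
  cancel₀ = solve 3 (λ s₀ a₀ p → (((s₀ :+ a₀) :+ p) :+ a₀) :+ p := s₀) refl
  cancel : ∀ s₀ a₀ s₁ a₁ p →
           (((s₀ xor a₀) xor p) xor a₁) xor (((s₀ xor a₀) xor (s₁ xor a₁)) xor p) ≡ s₁
  cancel = solve 5 (λ s₀ a₀ s₁ a₁ p →
    (((s₀ :+ a₀) :+ p) :+ a₁) :+ (((s₀ :+ a₀) :+ (s₁ :+ a₁)) :+ p) := s₁) refl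

-- The graph of a tree

size : Tree → ℕ
size leaf         = 0
size (node _ sub) = suc (size (sub 0F) ℕ.+ (size (sub 1F) ℕ.+ size (sub 2F)))

Pos-leaf↔ : Fin 0 ↔ Pos leaf
Pos-leaf↔ = mk↔ₛ′ (λ ()) (λ ()) (λ ()) (λ ())

Pos-node↔ : ∀ {σ sub} → (⊤ ⊎ (Pos (sub 0F) ⊎ (Pos (sub 1F) ⊎ Pos (sub 2F)))) ↔ Pos (node σ sub)
Pos-node↔ {σ} {sub} = mk↔ₛ′ to from
    (λ { here → refl ; (go 0F _) → refl ; (go 1F _) → refl ; (go 2F _) → refl })
    (λ { (inj₁ _) → refl ; (inj₂ (inj₁ _)) → refl
       ; (inj₂ (inj₂ (inj₁ _))) → refl ; (inj₂ (inj₂ (inj₂ _))) → refl })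
  where
  to : _ → Pos (node σ sub)
  to (inj₁ _)               = here
  to (inj₂ (inj₁ p))        = go 0F p
  to (inj₂ (inj₂ (inj₁ p))) = go 1F p
  to (inj₂ (inj₂ (inj₂ p))) = go 2F p
  from : Pos (node σ sub) → _
  from here      = inj₁ tt
  from (go 0F p) = inj₂ (inj₁ p)
  from (go 1F p) = inj₂ (inj₂ (inj₁ p))
  from (go 2F p) = inj₂ (inj₂ (inj₂ p))

+Fin : ∀ {m n} {A B : Set} → Fin m ↔ A → Fin n ↔ B → Fin (m ℕ.+ n) ↔ (A ⊎ B)
+Fin f g = (f ⊎-↔ g) ↔-∘ +↔⊎

Fin↔Pos : ∀ t → Fin (size t) ↔ Pos t
Fin↔Pos leaf         = Pos-leaf↔
Fin↔Pos (node σ sub) =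
  Pos-node↔ ↔-∘ (+Fin (1↔⊤) (+Fin (Fin↔Pos (sub 0F)) (+Fin (Fin↔Pos (sub 1F)) (Fin↔Pos (sub 2F)))))

Vertex : Tree → Set
Vertex t = Fin 3 ⊎ Pos t

order : Tree → ℕ
order t = 3 ℕ.+ size t

Fin↔Vertex : ∀ t → Fin (order t) ↔ Vertex t
Fin↔Vertex t = +Fin (↔-id _) (Fin↔Pos t)

vertex : ∀ t → Fin (order t) → Vertex t
vertex t = Inverse.to (Fin↔Vertex t)

index : ∀ t → Vertex t → Fin (order t)
index t = Inverse.from (Fin↔Vertex t)

index-vertex : ∀ t x → index t (vertex t x) ≡ x
index-vertex t = Inverse.strictlyInverseʳ (Fin↔Vertex t)

vertex-index : ∀ t u → vertex t (index t u) ≡ u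
vertex-index t = Inverse.strictlyInverseˡ (Fin↔Vertex t)

between-sym : ∀ {t} (p q : Pos t) → between p q ≡ between q p
between-sym here     here     = refl
between-sym here     (go _ _) = refl
between-sym (go _ _) here     = refl
between-sym (go k p) (go l q) with k ≟ l | l ≟ k
... | yes refl | yes refl = between-sym p q
... | yes refl | no  k≢k  = contradiction refl k≢k
... | no  k≢k  | yes refl = contradiction refl k≢k
... | no  _    | no  _    = refl

between-irrefl : ∀ {t} (p : Pos t) → between p p ≡ nothing
between-irrefl here           = refl
between-irrefl (go {σ} k p) = trans (between-go {σ} k p p) (between-irrefl p)

link : ∀ {t} → Vertex t → Vertex t → Maybe Sign
link (inj₁ _) (inj₁ _) = nothing
link (inj₁ i) (inj₂ p) = toCorner p i
link (inj₂ p) (inj₁ i) = toCorner p i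
link (inj₂ p) (inj₂ q) = between p q

link-sym : ∀ {t} (u v : Vertex t) → link u v ≡ link v u
link-sym (inj₁ _) (inj₁ _) = refl
link-sym (inj₁ _) (inj₂ _) = refl
link-sym (inj₂ _) (inj₁ _) = refl
link-sym (inj₂ p) (inj₂ q) = between-sym p q

link-irrefl : ∀ {t} (u : Vertex t) → link u u ≡ nothing
link-irrefl (inj₁ _) = refl
link-irrefl (inj₂ p) = between-irrefl p

T-is-just : ∀ {a} {A : Set a} {x : Maybe A} → T (is-just x) → ∃[ s ] x ≡ just s
T-is-just {x = just s} _ = s , refl

T-fromMaybe : ∀ {x} → T (fromMaybe pos x) → T (is-just x)
T-fromMaybe {just _} _ = tt

stacked : ∀ t → SimpleGraph (order t)
stacked t = record
  { adj    = λ x y → is-just (link (vertex t x) (vertex t y))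
  ; sym    = λ x y → cong is-just (link-sym (vertex t x) (vertex t y))
  ; irrefl = λ x → cong is-just (link-irrefl (vertex t x))
  }

labels : ∀ t → EdgeSet (stacked t)
labels t = record
  -- The default `pos` keeps non-adjacent pairs out of the set of negative edges.
  { mem    = λ x y → fromMaybe pos (link (vertex t x) (vertex t y))
  ; sym    = λ x y → cong (fromMaybe pos) (link-sym (vertex t x) (vertex t y))
  ; subset = λ x y → T-fromMaybe
  }

hom⇒realises : ∀ t {m} {H : SignifiedGraph m} → SignifiedHom (stacked t ,ₛ labels t) H →
               ∃[ c ] ∃[ g ] Realises H t c g
hom⇒realises t {H = H} f =
  image ∘ inj₁ , image ∘ inj₂ ,
  record { corner = λ p i → image-sign (inj₂ p) (inj₁ i) ; inner = λ p q → image-sign (inj₂ p) (inj₂ q) }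
  where
  open SignifiedHom f
  image = λ u → map (index t u)
  image-sign : ∀ u v {s} → link u v ≡ just s → HasSign H s (image u) (image v)
  image-sign u v {s} e =
    edge-pres (index t u) (index t v) adjacent ,
    trans (sign-pres (index t u) (index t v) adjacent) (cong (fromMaybe pos) link≡)
    where
    link≡ : link (vertex t (index t u)) (vertex t (index t v)) ≡ just s
    link≡ = trans (cong₂ link (vertex-index t u) (vertex-index t v)) e
    adjacent : T (is-just (link (vertex t (index t u)) (vertex t (index t v))))
    adjacent = subst (T ∘ is-just) (sym link≡) tt

-- The corners get the colours of any clique, since no edge joins two of them; the rest is coloured
-- by `colour`.
stacked-hom : ∀ {n} {H : SignifiedGraph n} → Extends H → ∃ (Clique H) →
              ∀ t (S : EdgeSet (stacked t)) → SignifiedHom (stacked t ,ₛ S) H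
stacked-hom {n} {H} extends (c , clique) t S
  with g , colours ← colour H extends t c clique
         (λ p i → EdgeSet.mem S (index t (inj₂ p)) (index t (inj₁ i)))
         (λ p q → EdgeSet.mem S (index t (inj₂ p)) (index t (inj₂ q)))
         (λ p q → EdgeSet.sym S _ _) = record
  { map       = λ x → f (vertex t x)
  ; edge-pres = λ x y a → HasSign.adjacent (f-sign x y a)
  ; sign-pres = λ x y a → HasSign.sign (f-sign x y a)
  }
  where
  open Colours
  τ : Vertex t → Vertex t → Sign
  τ u v = EdgeSet.mem S (index t u) (index t v)
  f : Vertex t → Fin n
  f = [ c , g ]′
  link-sign : ∀ u v {s} → link u v ≡ just s → HasSign H (τ u v) (f u) (f v)
  link-sign (inj₁ i) (inj₂ p) e =
    subst (λ s → HasSign H s (c i) (g p)) (EdgeSet.sym S _ _) (HasSign-sym (corner colours p i e))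
  link-sign (inj₂ p) (inj₁ i) e = corner colours p i e
  link-sign (inj₂ p) (inj₂ q) e = inner colours p q e
  f-sign : ∀ x y → T (SimpleGraph.adj (stacked t) x y) →
           HasSign H (EdgeSet.mem S x y) (f (vertex t x)) (f (vertex t y))
  f-sign x y a with _ , e ← T-is-just a =
    subst₂ (λ x′ y′ → HasSign H (EdgeSet.mem S x′ y′) (f (vertex t x)) (f (vertex t y)))
      (index-vertex t x) (index-vertex t y) (link-sign (vertex t x) (vertex t y) e)

cover-clique : ∃ (Clique cover)
cover-clique = c , toWitness {a? = all? λ i → all? λ j → ¬? (i ≟ j) →-dec T? (coverAdj (c i) (c j))} tt
  where
  c : Fin 3 → Fin 20
  c 0F = 0F
  c 1F = 1F
  c 2F = 2F

stacked-χ₂ : χ₂[ stacked (full (full leaf)) ]≡ 20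
stacked-χ₂ =
  (labels t , (cover , hom (labels t)) ,
   λ m (H , f) → let _ , _ , r = hom⇒realises t f in full-full⇒20≤ H r) ,
  λ m (S , _ , minimal) → minimal 20 (cover , hom S)
  where
  t = full (full leaf)
  hom : ∀ S → SignifiedHom (stacked t ,ₛ S) cover
  hom = stacked-hom cover-extends cover-clique t

-- Straight-line drawings

0<1 : 0ℚ < 1ℚ
0<1 = toWitness {a? = 0ℚ <? 1ℚ} tt

⅓ 3ℚ : ℚ
⅓  = ℤ.+ 1 / 3
3ℚ = ℤ.+ 3 / 1

0<⅓ : 0ℚ < ⅓
0<⅓ = toWitness {a? = 0ℚ <? ⅓} tt

lerp : ℚ → ℚ → ℚ → ℚ
lerp t u v = u + t * (v - u)

p<q⇒0<q-p : ∀ {p q} → p < q → 0ℚ < q - p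
p<q⇒0<q-p {p} {q} p<q = subst (_< q - p) (ℚ.+-inverseʳ p) (ℚ.+-monoˡ-< (- p) p<q)

*-nonneg : ∀ {p q} → 0ℚ ≤ p → 0ℚ ≤ q → 0ℚ ≤ p * q
*-nonneg {p} {q} 0≤p 0≤q =
  ℚ.nonNegative⁻¹ (p * q) {{ℚ.nonNeg*nonNeg⇒nonNeg p {{nonNegative 0≤p}} q {{nonNegative 0≤q}}}}

*-pos : ∀ {p q} → 0ℚ < p → 0ℚ < q → 0ℚ < p * q
*-pos {p} {q} 0<p 0<q =
  ℚ.positive⁻¹ (p * q) {{ℚ.pos*pos⇒pos p {{positive 0<p}} q {{positive 0<q}}}}

module _ where
  open ℚ-Solver

  lerp-1 : ∀ u v → lerp 1ℚ u v ≡ v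
  lerp-1 = solve 2 (λ u v → u :+ con 1ℚ :* (v :- u) := v) refl

  lerp-convex : ∀ t u v → (1ℚ - t) * u + t * v ≡ lerp t u v
  lerp-convex = solve 3 (λ t u v → (con 1ℚ :- t) :* u :+ t :* v := u :+ t :* (v :- u)) refl

  lerp-flip : ∀ t u v → lerp t u v ≡ lerp (1ℚ - t) v u
  lerp-flip = solve 3 (λ t u v → u :+ t :* (v :- u) := v :+ (con 1ℚ :- t) :* (u :- v)) refl

lerp-pos : ∀ {t u v} → 0ℚ ≤ t → t < 1ℚ → 0ℚ < u → 0ℚ ≤ v → 0ℚ < lerp t u v
lerp-pos {t} {u} {v} 0≤t t<1 0<u 0≤v = subst (0ℚ <_) (lerp-convex t u v)
  (ℚ.+-mono-<-≤ (*-pos (p<q⇒0<q-p t<1) 0<u) (*-nonneg 0≤t 0≤v))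

≤1⇒<1∨≡1 : ∀ {t} → t ≤ 1ℚ → t < 1ℚ ⊎ t ≡ 1ℚ
≤1⇒<1∨≡1 {t} t≤1 with t <? 1ℚ
... | yes t<1 = inj₁ t<1
... | no  t≮1 = inj₂ (ℚ.≤-antisym t≤1 (ℚ.≮⇒≥ t≮1))

-- Barycentric coordinates with respect to the current triangle.
Coords : Set
Coords = Fin 3 → ℚ

Interior : Coords → Set
Interior x = ∀ i → 0ℚ < x i

unit : Fin 3 → Coords
unit i j = if does (i ≟ j) then 1ℚ else 0ℚ

-- zoomOut k turns coordinates relative to the triangle in which corner k is
-- replaced by the centroid into coordinates relative to the whole triangle.
zoomOut zoomIn : Fin 3 → Coords → Coords
zoomOut k y i = (y [ k ]≔ 0ℚ) i + ⅓ * y k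
zoomIn  k x   = (λ i → x i - x k) [ k ]≔ 3ℚ * x k

locate : ∀ {t} → Pos t → Coords
locate here     = const ⅓
locate (go k p) = zoomOut k (locate p)

place : ∀ {t} → Vertex t → Coords
place (inj₁ i) = unit i
place (inj₂ p) = locate p

embed : ∀ {σ sub} k → Vertex (sub k) → Vertex (node σ sub)
embed k (inj₁ i) = (inj₁ [ k ]≔ inj₂ here) i
embed k (inj₂ p) = inj₂ (go k p)

OnSeg : Coords → Coords → Coords → Set
OnSeg u v x = ∃[ t ] (0ℚ ≤ t × t ≤ 1ℚ × ∀ i → x i ≡ lerp t (u i) (v i))

OnSeg-resp : ∀ {u u′ v v′ x} → u ≗ u′ → v ≗ v′ → OnSeg u v x → OnSeg u′ v′ x
OnSeg-resp u≗ v≗ (t , 0≤t , t≤1 , x≡) =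
  t , 0≤t , t≤1 , λ i → trans (x≡ i) (cong₂ (lerp t) (u≗ i) (v≗ i))

module _ where
  open ℚ-Solver

  -- The weight `y k` of the centroid is spread equally over the corners. Corner `k` holds just this
  -- third, so it is tripled to recover `y k` and subtracted elsewhere.
  zoomIn-zoomOut : ∀ k y → zoomIn k (zoomOut k y) ≗ y
  zoomIn-zoomOut k y i with i ≟ k | k ≟ k
  ... | _        | no k≢k = contradiction refl k≢k
  ... | yes refl | yes _  =
    solve 1 (λ y → con 3ℚ :* (con 0ℚ :+ con ⅓ :* y) := y) refl (y k)
  ... | no _     | yes _  =
    solve 2 (λ y z → (y :+ con ⅓ :* z) :- (con 0ℚ :+ con ⅓ :* z) := y) refl (y i) (y k)

  zoomOut-zoomIn : ∀ k x → zoomOut k (zoomIn k x) ≗ x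
  zoomOut-zoomIn k x i with i ≟ k | k ≟ k
  ... | _        | no k≢k = contradiction refl k≢k
  ... | yes refl | yes _  =
    solve 1 (λ x → con 0ℚ :+ con ⅓ :* (con 3ℚ :* x) := x) refl (x k)
  ... | no i≢k   | yes _  =
    solve 2 (λ x z → (x :- z) :+ con ⅓ :* (con 3ℚ :* z) := x) refl (x i) (x k)

  zoomIn-lerp : ∀ {t u v x} k → (∀ i → x i ≡ lerp t (u i) (v i)) →
                ∀ i → zoomIn k x i ≡ lerp t (zoomIn k u i) (zoomIn k v i)
  zoomIn-lerp {t} {u} {v} k x≡ i with i ≟ k
  ... | yes _ = trans (cong (3ℚ *_) (x≡ k))
    (solve 3 (λ t u v → con 3ℚ :* (u :+ t :* (v :- u)) :=
                        con 3ℚ :* u :+ t :* (con 3ℚ :* v :- con 3ℚ :* u)) refl t (u k) (v k))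
  ... | no  _ = trans (cong₂ _-_ (x≡ i) (x≡ k))
    (solve 5 (λ t u v u′ v′ → (u :+ t :* (v :- u)) :- (u′ :+ t :* (v′ :- u′)) :=
                              (u :- u′) :+ t :* ((v :- v′) :- (u :- u′)))
       refl t (u i) (v i) (u k) (v k))

unit-diag : ∀ i → unit i i ≡ 1ℚ
unit-diag i with i ≟ i
... | yes _   = refl
... | no  i≢i = contradiction refl i≢i

unit-off : ∀ {i j} → i ≢ j → unit i j ≡ 0ℚ
unit-off {i} {j} i≢j with i ≟ j
... | yes i≡j = contradiction i≡j i≢j
... | no  _   = refl

unit-nonneg : ∀ i j → 0ℚ ≤ unit i j
unit-nonneg i j with i ≟ j
... | yes _ = ℚ.<⇒≤ 0<1
... | no  _ = ℚ.≤-refl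

zoomIn-cong : ∀ k {x y} → x ≗ y → zoomIn k x ≗ zoomIn k y
zoomIn-cong k x≗y i with i ≟ k
... | yes _ = cong (3ℚ *_) (x≗y k)
... | no  _ = cong₂ _-_ (x≗y i) (x≗y k)

zoomOut-cong : ∀ k {x y} → x ≗ y → zoomOut k x ≗ zoomOut k y
zoomOut-cong k x≗y i with i ≟ k
... | yes _ = cong (λ z → 0ℚ + ⅓ * z) (x≗y k)
... | no  _ = cong₂ (λ z w → z + ⅓ * w) (x≗y i) (x≗y k)

zoomOut-interior : ∀ k {y} → Interior y → Interior (zoomOut k y)
zoomOut-interior k {y} y>0 i with i ≟ k
... | yes _ = ℚ.+-mono-≤-< (ℚ.≤-refl {0ℚ}) (*-pos 0<⅓ (y>0 k))
... | no  _ = ℚ.+-mono-< (y>0 i) (*-pos 0<⅓ (y>0 k))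

zoomOut-unit : ∀ {σ sub} k i → zoomOut k (unit i) ≗ place {node σ sub} (embed k (inj₁ i))
zoomOut-unit {σ} {sub} = toWitness {a? = Fin.all? λ k → Fin.all? λ i → Fin.all? λ j →
  zoomOut k (unit i) j ℚ.≟ place {node σ sub} (embed k (inj₁ i)) j} tt

place-embed : ∀ {σ sub} k (v : Vertex (sub k)) → zoomOut k (place v) ≗ place (embed {σ} {sub} k v)
place-embed {σ} {sub} k (inj₁ i) = zoomOut-unit {σ} {sub} k i
place-embed k (inj₂ p) = λ _ → refl

zoomIn-place : ∀ {σ sub} k (v : Vertex (sub k)) → zoomIn k (place (embed {σ} {sub} k v)) ≗ place v
zoomIn-place {σ} {sub} k v i =
  trans (sym (zoomIn-cong k (place-embed {σ} {sub} k v) i)) (zoomIn-zoomOut k (place v) i)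

place-zoomIn : ∀ {σ sub} k (v : Vertex (sub k)) {x} → zoomIn k x ≗ place v →
               x ≗ place (embed {σ} {sub} k v)
place-zoomIn {σ} {sub} k v {x} x≗ i = trans (sym (zoomOut-zoomIn k x i))
  (trans (zoomOut-cong k x≗ i) (place-embed {σ} {sub} k v i))

locate-interior : ∀ {t} (p : Pos t) → Interior (locate p)
locate-interior here     i = 0<⅓
locate-interior (go k p) i = zoomOut-interior k (locate-interior p) i

place-nonneg : ∀ {t} (v : Vertex t) i → 0ℚ ≤ place v i
place-nonneg (inj₁ j) i = unit-nonneg j i
place-nonneg (inj₂ p) i = ℚ.<⇒≤ (locate-interior p i)

Interior-resp : ∀ {x y} → x ≗ y → Interior x → Interior y
Interior-resp x≗y x>0 i = subst (0ℚ <_) (x≗y i) (x>0 i)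

third : ∀ (i j : Fin 3) → ∃[ k ] k ≢ i × k ≢ j
third 0F 0F = 1F , (λ ()) , (λ ())
third 0F 1F = 2F , (λ ()) , (λ ())
third 0F 2F = 1F , (λ ()) , (λ ())
third 1F 0F = 2F , (λ ()) , (λ ())
third 1F 1F = 0F , (λ ()) , (λ ())
third 1F 2F = 0F , (λ ()) , (λ ())
third 2F 0F = 1F , (λ ()) , (λ ())
third 2F 1F = 0F , (λ ()) , (λ ())
third 2F 2F = 0F , (λ ()) , (λ ())

unit-not-interior : ∀ i → ¬ Interior (unit i)
unit-not-interior i u>0 with j , j≢i , _ ← third i i =
  ℚ.<-irrefl (sym (unit-off (j≢i ∘ sym))) (u>0 j)

zoomIn-off : ∀ {k i} x → i ≢ k → zoomIn k x i ≡ x i - x k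
zoomIn-off {k} {i} x i≢k with i ≟ k
... | yes i≡k = contradiction i≡k i≢k
... | no  _   = refl

-- The two assumptions would give both `x k < x l` and `x l < x k`.
zoomIn-disjoint : ∀ {k l} x → k ≢ l → Interior (zoomIn k x) → ¬ Interior (zoomIn l x)
zoomIn-disjoint {k} {l} x k≢l xₖ>0 xₗ>0 = ℚ.<-irrefl (sym opposite)
  (ℚ.+-mono-< (subst (0ℚ <_) (zoomIn-off x (k≢l ∘ sym)) (xₖ>0 l))
              (subst (0ℚ <_) (zoomIn-off x k≢l) (xₗ>0 k)))
  where
  open ℚ-Solver
  opposite : (x l - x k) + (x k - x l) ≡ 0ℚ
  opposite = solve 2 (λ a b → (a :- b) :+ (b :- a) := con 0ℚ) refl (x l) (x k)

-- On the segment from the centroid to corner i, every coordinate other than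
-- the i-th one is minimal.
spoke-not-interior : ∀ i {x} k → OnSeg (const ⅓) (unit i) x → ¬ Interior (zoomIn k x)
spoke-not-interior i {x} k (t , 0≤t , _ , x≡) x>0
  with j , j≢k , j≢i ← third k i =
  ℚ.<-irrefl refl (ℚ.<-≤-trans (subst (0ℚ <_) (zoomIn-off x j≢k) (x>0 j)) difference≤0)
  where
  open ℚ-Solver
  difference : x j - x k ≡ - (t * unit i k)
  difference = trans
    (cong₂ _-_ (trans (x≡ j) (cong (lerp t ⅓) (unit-off (j≢i ∘ sym)))) (x≡ k))
    (solve 2 (λ t u → (con ⅓ :+ t :* (con 0ℚ :- con ⅓)) :- (con ⅓ :+ t :* (u :- con ⅓)) :=
                      :- (t :* u)) refl t (unit i k))
  difference≤0 : x j - x k ≤ 0ℚ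
  difference≤0 = subst (_≤ 0ℚ) (sym difference) (ℚ.neg-antimono-≤ (*-nonneg 0≤t (unit-nonneg i k)))

-- Edges of the drawing and where they meet

data TreeEdge : Tree → Set where
  spoke  : ∀ {σ sub} → Fin 3 → TreeEdge (node σ sub)
  inside : ∀ {σ sub} k → TreeEdge (sub k) → TreeEdge (node σ sub)

-- Edges are directed from the vertex stacked later, so that the start is always interior to the
-- triangle.
start : ∀ {t} → TreeEdge t → Pos t
start (spoke i)    = here
start (inside k e) = go k (start e)

end : ∀ {t} → TreeEdge t → Vertex t
end (spoke i)            = inj₁ i
end (inside {σ} {sub} k e) = embed {σ} {sub} k (end e)

OnEdge : ∀ {t} → TreeEdge t → Coords → Set
OnEdge e = OnSeg (locate (start e)) (place (end e))

OnEdge-zoomIn : ∀ {σ sub x} k (e : TreeEdge (sub k)) → OnEdge (inside {σ} {sub} k e) x → OnEdge e (zoomIn k x)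
OnEdge-zoomIn {σ} {sub} k e (t , 0≤t , t≤1 , x≡) =
  OnSeg-resp (zoomIn-zoomOut k (locate (start e))) (zoomIn-place {σ} {sub} k (end e))
    (t , 0≤t , t≤1 ,
     zoomIn-lerp {t} {u = zoomOut k (locate (start e))} {v = place (embed {σ} {sub} k (end e))} k x≡)

-- Since the start is interior, so is every point short of the far end; the far end is interior too
-- unless it is a corner.
edge-region : ∀ {t x} (e : TreeEdge t) → OnEdge e x →
              Interior x ⊎ ∃[ i ] (end e ≡ inj₁ i × x ≗ unit i)
edge-region {x = x} e (t , 0≤t , t≤1 , x≡) with ≤1⇒<1∨≡1 t≤1
... | inj₁ t<1  = inj₁ λ i → subst (0ℚ <_) (sym (x≡ i))
  (lerp-pos 0≤t t<1 (locate-interior (start e) i) (place-nonneg (end e) i))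
... | inj₂ refl = at-end (end e) refl
  where
  x≗end : x ≗ place (end e)
  x≗end i = trans (x≡ i) (lerp-1 (locate (start e) i) (place (end e) i))
  at-end : ∀ v → end e ≡ v → Interior x ⊎ ∃[ i ] (end e ≡ inj₁ i × x ≗ unit i)
  at-end (inj₁ i) end≡ = inj₂ (i , end≡ , λ j → trans (x≗end j) (cong (λ v → place v j) end≡))
  at-end (inj₂ p) end≡ = inj₁ (Interior-resp
    (λ j → sym (trans (x≗end j) (cong (λ v → place v j) end≡))) (locate-interior p))

-- For a third index `k`, coordinates `i` and `k` differ by exactly `s` on spoke `i` and agree on
-- spoke `j`, whence `s ≡ 0ℚ`.
spokes-meet : ∀ {i j x} → i ≢ j → OnSeg (const ⅓) (unit i) x → OnSeg (const ⅓) (unit j) x → x ≗ const ⅓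
spokes-meet {i} {j} {x} i≢j (s , _ , _ , x≡s) (t , _ , _ , x≡t) l
  with k , k≢i , k≢j ← third i j = trans (x≡s l) (trans (cong (λ s → lerp s ⅓ (unit i l)) s≡0)
    (solve 1 (λ u → con ⅓ :+ con 0ℚ :* (u :- con ⅓) := con ⅓) refl (unit i l)))
  where
  open ℚ-Solver
  x-i = trans (sym (x≡s i)) (trans (x≡t i) (cong (lerp t ⅓) (unit-off (i≢j ∘ sym))))
  x-k = trans (sym (x≡s k)) (trans (x≡t k) (cong (lerp t ⅓) (unit-off (k≢j ∘ sym))))
  s≡0 : s ≡ 0ℚ
  s≡0 = begin
    s
      ≡⟨ solve 1 (λ s → s := (con ⅓ :+ s :* (con 1ℚ :- con ⅓)) :- (con ⅓ :+ s :* (con 0ℚ :- con ⅓)))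
           refl s ⟩
    lerp s ⅓ 1ℚ - lerp s ⅓ 0ℚ
      ≡⟨ cong₂ (λ a b → lerp s ⅓ a - lerp s ⅓ b) (unit-diag i) (unit-off (k≢i ∘ sym)) ⟨
    lerp s ⅓ (unit i i) - lerp s ⅓ (unit i k)
      ≡⟨ cong₂ _-_ x-i x-k ⟩
    lerp t ⅓ 0ℚ - lerp t ⅓ 0ℚ
      ≡⟨ ℚ.+-inverseʳ (lerp t ⅓ 0ℚ) ⟩
    0ℚ ∎
    where open ≡-Reasoning

-- An edge leaves the open subtriangle only at an end that is a corner.
inside-meets : ∀ {σ sub x} k (e : TreeEdge (sub k)) → OnEdge (inside {σ} {sub} k e) x →
               ¬ Interior (zoomIn k x) → ∃[ v ] x ≗ place {node σ sub} v
inside-meets {σ} {sub} k e x∈e outside with edge-region e (OnEdge-zoomIn {σ} {sub} k e x∈e)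
... | inj₁ xₖ>0         = contradiction xₖ>0 outside
... | inj₂ (i , _ , x≗) = embed k (inj₁ i) , place-zoomIn {σ} {sub} k (inj₁ i) x≗

-- Spokes miss the open subtriangles, and these are disjoint, so only two edges in the same
-- subtriangle require recursion.
edges-meet : ∀ {t} (e f : TreeEdge t) {x} → OnEdge e x → OnEdge f x → e ≡ f ⊎ ∃[ v ] x ≗ place {t} v
edges-meet (spoke i) (spoke j) x∈e x∈f with i ≟ j
... | yes refl = inj₁ refl
... | no  i≢j  = inj₂ (inj₂ here , spokes-meet i≢j x∈e x∈f)
edges-meet (spoke i) (inside {σ} {sub} k f) x∈e x∈f =
  inj₂ (inside-meets {σ} {sub} k f x∈f (spoke-not-interior i k x∈e))
edges-meet (inside {σ} {sub} k e) (spoke j) x∈e x∈f =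
  inj₂ (inside-meets {σ} {sub} k e x∈e (spoke-not-interior j k x∈f))
edges-meet (inside {σ} {sub} k e) (inside l f) {x} x∈e x∈f with k ≟ l
... | yes refl = Sum.map (cong (inside k)) (λ (v , x≗) → embed k v , place-zoomIn {σ} {sub} k v x≗)
                   (edges-meet e f (OnEdge-zoomIn {σ} {sub} k e x∈e) (OnEdge-zoomIn {σ} {sub} k f x∈f))
... | no  k≢l with edge-region e (OnEdge-zoomIn {σ} {sub} k e x∈e)
...   | inj₁ xₖ>0          = inj₂ (inside-meets {σ} {sub} l f x∈f (zoomIn-disjoint x k≢l xₖ>0))
...   | inj₂ (i , _ , x≗) = inj₂ (embed k (inj₁ i) , place-zoomIn {σ} {sub} k (inj₁ i) x≗)

locate≢unit : ∀ {t} (p : Pos t) i → ¬ locate p ≗ unit i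
locate≢unit p i e = unit-not-interior i (Interior-resp e (locate-interior p))

zoomIn-interior : ∀ {t} k (p : Pos t) x → x ≗ zoomOut k (locate p) → Interior (zoomIn k x)
zoomIn-interior k p x x≗ = Interior-resp
  (λ i → sym (trans (zoomIn-cong k x≗ i) (zoomIn-zoomOut k (locate p) i))) (locate-interior p)

here-not-interior : ∀ k → ¬ Interior (zoomIn k (const ⅓))
here-not-interior k = spoke-not-interior 0F k
  (0ℚ , ℚ.≤-refl , ℚ.<⇒≤ 0<1 , λ i → sym (solve 1 (λ u → con ⅓ :+ con 0ℚ :* (u :- con ⅓) := con ⅓) refl (unit 0F i)))
  where open ℚ-Solver

-- Corners are not interior, the centroid lies in no open subtriangle, and the open subtriangles are
-- disjoint.
place-injective : ∀ {t} (u v : Vertex t) → place u ≗ place v → u ≡ v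
place-injective (inj₁ i) (inj₁ j) e with i ≟ j
... | yes refl = refl
... | no  i≢j  = contradiction
  (trans (sym (unit-diag i)) (trans (e i) (unit-off (i≢j ∘ sym)))) (λ ())
place-injective (inj₁ i) (inj₂ p) e = contradiction (λ i → sym (e i)) (locate≢unit p i)
place-injective (inj₂ p) (inj₁ i) e = contradiction e (locate≢unit p i)
place-injective (inj₂ here) (inj₂ here) e = refl
place-injective (inj₂ here) (inj₂ (go k q)) e = contradiction (zoomIn-interior k q (const ⅓) e) (here-not-interior k)
place-injective (inj₂ (go k p)) (inj₂ here) e =
  contradiction (zoomIn-interior k p (const ⅓) (λ i → sym (e i))) (here-not-interior k)
place-injective (inj₂ (go k p)) (inj₂ (go l q)) e with k ≟ l
... | yes refl = cong (embed k) (place-injective (inj₂ p) (inj₂ q) λ i →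
  trans (sym (zoomIn-zoomOut k (locate p) i))
    (trans (zoomIn-cong k e i) (zoomIn-zoomOut k (locate q) i)))
... | no  k≢l  = contradiction (zoomIn-interior l q (zoomOut k (locate p)) e)
  (zoomIn-disjoint (zoomOut k (locate p)) k≢l (zoomIn-interior k p (zoomOut k (locate p)) (λ _ → refl)))

embed-replaced : ∀ {σ sub} k → embed {σ} {sub} k (inj₁ k) ≡ inj₂ here
embed-replaced k with k ≟ k
... | yes _   = refl
... | no  k≢k = contradiction refl k≢k

embed-corner≢go : ∀ {σ sub k p} l i → inj₂ (go k p) ≢ embed {σ} {sub} l (inj₁ i)
embed-corner≢go l i e with i ≟ l
embed-corner≢go l i () | yes _
embed-corner≢go l i () | no  _

vertex-on-edge : ∀ {t} (e : TreeEdge t) (v : Vertex t) {x} → OnEdge e x → x ≗ place v →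
                 v ≡ inj₂ (start e) ⊎ v ≡ end e
vertex-on-edge e (inj₁ j) x∈e x≗ with edge-region e x∈e
... | inj₁ x>0 = contradiction (Interior-resp x≗ x>0) (unit-not-interior j)
... | inj₂ (i , end≡ , x≗i) =
  inj₂ (trans (place-injective (inj₁ j) (inj₁ i) (λ l → trans (sym (x≗ l)) (x≗i l))) (sym end≡))
vertex-on-edge (spoke i) (inj₂ here) x∈e x≗ = inj₁ refl
vertex-on-edge (spoke i) (inj₂ (go k p)) x∈e x≗ =
  contradiction (zoomIn-interior k p _ x≗) (spoke-not-interior i k x∈e)
-- Seen from subtriangle `l`, the vertex `here` is its corner `l`.
vertex-on-edge (inside {σ} {sub} l e) (inj₂ here) x∈e x≗
  with vertex-on-edge e (inj₁ l) (OnEdge-zoomIn {σ} {sub} l e x∈e) (λ i →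
         trans (zoomIn-cong l x≗ i)
           (trans (cong (λ v → zoomIn l (place v) i) (sym (embed-replaced {σ} {sub} l)))
                  (zoomIn-place {σ} {sub} l (inj₁ l) i)))
... | inj₂ l≡end = inj₂ (trans (sym (embed-replaced {σ} {sub} l)) (cong (embed l) l≡end))
vertex-on-edge (inside {σ} {sub} l e) (inj₂ (go k p)) {x} x∈e x≗ with k ≟ l
... | yes refl = Sum.map (cong (embed k)) (cong (embed k))
  (vertex-on-edge e (inj₂ p) (OnEdge-zoomIn {σ} {sub} k e x∈e)
    (λ i → trans (zoomIn-cong k x≗ i) (zoomIn-zoomOut k (locate p) i)))
... | no  k≢l  with edge-region e (OnEdge-zoomIn {σ} {sub} l e x∈e)
...   | inj₁ xₗ>0 = contradiction xₗ>0 (zoomIn-disjoint x k≢l (zoomIn-interior k p _ x≗))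
-- A corner of a subtriangle is an outer corner or `here`, never a vertex stacked deeper.
...   | inj₂ (i , _ , xₗ≗) = contradiction
  (place-injective (inj₂ (go {σ} {sub} k p)) (embed {σ} {sub} l (inj₁ i))
    (λ j → trans (sym (x≗ j)) (place-zoomIn {σ} {sub} l (inj₁ i) {x} xₗ≗ j)))
  (embed-corner≢go l i)

-- Adjacent vertices as tree edges

Directed Joins : ∀ {t} → Vertex t → Vertex t → TreeEdge t → Set
Directed u v e = inj₂ (start e) ≡ u × end e ≡ v
Joins u v e    = Directed u v e ⊎ Directed v u e

embed-directed : ∀ {σ sub} k {u v} {e : TreeEdge (sub k)} → Directed u v e →
                 Directed (embed {σ} {sub} k u) (embed {σ} {sub} k v) (inside k e)
embed-directed {σ} {sub} k (refl , refl) = refl , refl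

toCorner⇒edge : ∀ {t} (p : Pos t) i {s} → toCorner p i ≡ just s → ∃ (Directed (inj₂ p) (inj₁ i))
toCorner⇒edge here     i _ = spoke i , refl , refl
toCorner⇒edge (go {σ} {sub} k p) i eq with i ≟ k in i≟k
... | no _ with e , start≡ , end≡ ← toCorner⇒edge p i eq =
  inside k e , cong (embed {σ} {sub} k) start≡ ,
  trans (cong (embed {σ} {sub} k) end≡) (cong (λ d → if does d then inj₂ here else inj₁ i) i≟k)

replaced⇒edge : ∀ {σ sub} k (p : Pos (sub k)) {s} → toCorner p k ≡ just s →
                ∃ (Directed {node σ sub} (inj₂ (go k p)) (inj₂ here))
replaced⇒edge {σ} {sub} k p eq with e , start≡ , end≡ ← toCorner⇒edge p k eq =
  inside k e , cong (embed {σ} {sub} k) start≡ ,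
  trans (cong (embed {σ} {sub} k) end≡) (embed-replaced {σ} {sub} k)

between⇒edge : ∀ {t} (p q : Pos t) {s} → between p q ≡ just s → ∃ (Joins (inj₂ p) (inj₂ q))
between⇒edge here     (go k q) eq = let e , directed = replaced⇒edge k q eq in e , inj₂ directed
between⇒edge (go k p) here     eq = let e , directed = replaced⇒edge k p eq in e , inj₁ directed
between⇒edge (go {σ} {sub} k p) (go l q) eq with k ≟ l
... | yes refl with e , joins ← between⇒edge p q eq =
  inside k e , Sum.map (embed-directed {σ} {sub} k) (embed-directed {σ} {sub} k) joins

link⇒edge : ∀ {t} (u v : Vertex t) {s} → link u v ≡ just s → ∃ (Joins u v)
link⇒edge (inj₁ i) (inj₂ p) eq = let e , directed = toCorner⇒edge p i eq in e , inj₂ directed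
link⇒edge (inj₂ p) (inj₁ i) eq = let e , directed = toCorner⇒edge p i eq in e , inj₁ directed
link⇒edge (inj₂ p) (inj₂ q) eq = between⇒edge p q eq

-- From barycentric to plane coordinates

plane : Coords → Point
plane x = x 0F , x 1F

-- The corners are drawn at (1, 0), (0, 1) and (0, 0). Barycentric coordinates sum to 1, which
-- recovers the third one.
coords : Point → Coords
coords (a , b) 0F = a
coords (a , b) 1F = b
coords (a , b) 2F = (1ℚ - a) - b

Normal : Coords → Set
Normal x = x 2F ≡ (1ℚ - x 0F) - x 1F

coords-plane : ∀ {x} → Normal x → coords (plane x) ≗ x
coords-plane n 0F = refl
coords-plane n 1F = refl
coords-plane n 2F = sym n

zoomOut-normal : ∀ k y → Normal y → Normal (zoomOut k y)
zoomOut-normal 0F y n = trans (cong (_+ ⅓ * y 0F) n)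
  (solve 2 (λ a b → ((con 1ℚ :- a) :- b) :+ con ⅓ :* a :=
                    (con 1ℚ :- (con 0ℚ :+ con ⅓ :* a)) :- (b :+ con ⅓ :* a)) refl (y 0F) (y 1F))
  where open ℚ-Solver
zoomOut-normal 1F y n = trans (cong (_+ ⅓ * y 1F) n)
  (solve 2 (λ a b → ((con 1ℚ :- a) :- b) :+ con ⅓ :* b :=
                    (con 1ℚ :- (a :+ con ⅓ :* b)) :- (con 0ℚ :+ con ⅓ :* b)) refl (y 0F) (y 1F))
  where open ℚ-Solver
zoomOut-normal 2F y n rewrite n =
  solve 2 (λ a b → let c = (con 1ℚ :- a) :- b in con 0ℚ :+ con ⅓ :* c :=
                    (con 1ℚ :- (a :+ con ⅓ :* c)) :- (b :+ con ⅓ :* c)) refl (y 0F) (y 1F)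
  where open ℚ-Solver

place-normal : ∀ {t} (v : Vertex t) → Normal (place v)
place-normal (inj₁ 0F)       = refl
place-normal (inj₁ 1F)       = refl
place-normal (inj₁ 2F)       = refl
place-normal (inj₂ here)     = refl
place-normal (inj₂ (go k p)) = zoomOut-normal k (locate p) (place-normal (inj₂ p))

OnSegment⇒OnSeg : ∀ u v {x} → Normal u → Normal v → OnSegment (plane u) (plane v) x → OnSeg u v (coords x)
OnSegment⇒OnSeg u v nu nv (t , 0≤t , t≤1 , refl) = t , 0≤t , t≤1 , λ
  { 0F → refl
  ; 1F → refl
  ; 2F → trans
      (solve 5 (λ t a b c d → (con 1ℚ :- (a :+ t :* (c :- a))) :- (b :+ t :* (d :- b)) :=
                 ((con 1ℚ :- a) :- b) :+ t :* (((con 1ℚ :- c) :- d) :- ((con 1ℚ :- a) :- b)))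
         refl t (u 0F) (u 1F) (v 0F) (v 1F))
      (cong₂ (lerp t) (sym nu) (sym nv))
  }
  where open ℚ-Solver

OnSeg-flip : ∀ u v {x} → OnSeg u v x → OnSeg v u x
OnSeg-flip u v (t , 0≤t , t≤1 , x≡) =
  1ℚ - t ,
  subst (_≤ 1ℚ - t) (ℚ.+-inverseʳ t) (ℚ.+-monoˡ-≤ (- t) t≤1) ,
  subst (1ℚ - t ≤_) (ℚ.+-identityʳ 1ℚ) (ℚ.+-monoʳ-≤ 1ℚ (ℚ.neg-antimono-≤ 0≤t)) ,
  λ i → trans (x≡ i) (lerp-flip t (u i) (v i))

joins⇒OnEdge : ∀ {t} {u v : Vertex t} e {x} → Joins u v e →
               OnSegment (plane (place u)) (plane (place v)) x → OnEdge e (coords x)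
joins⇒OnEdge e (inj₁ (refl , refl)) x∈ =
  OnSegment⇒OnSeg (locate (start e)) (place (end e))
    (place-normal (inj₂ (start e))) (place-normal (end e)) x∈
joins⇒OnEdge e (inj₂ (refl , refl)) x∈ =
  OnSeg-flip (place (end e)) (locate (start e))
    (OnSegment⇒OnSeg (place (end e)) (locate (start e))
      (place-normal (end e)) (place-normal (inj₂ (start e))) x∈)

joins-unique : ∀ {t} {u v u′ v′ : Vertex t} {e} → Joins u v e → Joins u′ v′ e →
               (u ≡ u′ × v ≡ v′) ⊎ (u ≡ v′ × v ≡ u′)
joins-unique (inj₁ (refl , refl)) (inj₁ (refl , refl)) = inj₁ (refl , refl)
joins-unique (inj₁ (refl , refl)) (inj₂ (refl , refl)) = inj₂ (refl , refl)
joins-unique (inj₂ (refl , refl)) (inj₁ (refl , refl)) = inj₂ (refl , refl)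
joins-unique (inj₂ (refl , refl)) (inj₂ (refl , refl)) = inj₁ (refl , refl)

module _ (t : Tree) where
  open SimpleGraph (stacked t) using (Edge; edge)
  open Edge

  vertex-injective : ∀ {x y} → vertex t x ≡ vertex t y → x ≡ y
  vertex-injective {x} {y} e =
    trans (sym (index-vertex t x)) (trans (cong (index t) e) (index-vertex t y))

  position : Fin (order t) → Point
  position x = plane (place (vertex t x))

  coords-position : ∀ x → coords (position x) ≗ place (vertex t x)
  coords-position x = coords-plane (place-normal (vertex t x))

  position-injective : ∀ x y → position x ≡ position y → x ≡ y
  position-injective x y e = vertex-injective (place-injective _ _ λ i →
    trans (sym (coords-position x i)) (trans (cong (λ p → coords p i) e) (coords-position y i)))

  edge-joins : (e : Edge) → ∃ (Joins (vertex t (src e)) (vertex t (tgt e)))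
  edge-joins e = link⇒edge _ _ (proj₂ (T-is-just (adjacent e)))

  Edge-≡ : ∀ {e f : Edge} → src e ≡ src f → tgt e ≡ tgt f → e ≡ f
  Edge-≡ {edge _ _ lt a} {edge _ _ lt′ a′} refl refl =
    cong₂ (edge _ _) (ℕ.<-irrelevant lt lt′) (T-irrelevant a a′)

  straight : (e : Edge) → Point → Set
  straight e = OnPolyline (position (src e) ∷ position (tgt e) ∷ [])

  straight⇒OnEdge : ∀ e {x} → straight e x → OnEdge (proj₁ (edge-joins e)) (coords x)
  straight⇒OnEdge e (here x∈) = joins⇒OnEdge (proj₁ (edge-joins e)) (proj₂ (edge-joins e)) x∈

  same-edge : ∀ e f → proj₁ (edge-joins e) ≡ proj₁ (edge-joins f) → e ≡ f
  same-edge e f eq with joins-unique (proj₂ (edge-joins e)) (subst (Joins _ _) (sym eq) (proj₂ (edge-joins f)))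
  ... | inj₁ (s , t) = Edge-≡ (vertex-injective s) (vertex-injective t)
  -- Opposite directions are excluded because both edges list their ends in increasing order.
  ... | inj₂ (s , t) = contradiction
    (subst₂ Fin._<_ (vertex-injective s) (vertex-injective t) (src<tgt e)) (Fin.<-asym (src<tgt f))

  straight-vertex : ∀ e v → straight e (position v) → v ≡ src e ⊎ v ≡ tgt e
  straight-vertex e v v∈
    with proj₂ (edge-joins e) | vertex-on-edge (proj₁ (edge-joins e)) (vertex t v)
                                  (straight⇒OnEdge e v∈) (coords-position v)
  ... | inj₁ (s , _) | inj₁ v≡ = inj₁ (vertex-injective (trans v≡ s))
  ... | inj₁ (_ , t) | inj₂ v≡ = inj₂ (vertex-injective (trans v≡ t))
  ... | inj₂ (s , _) | inj₁ v≡ = inj₂ (vertex-injective (trans v≡ s))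
  ... | inj₂ (_ , t) | inj₂ v≡ = inj₁ (vertex-injective (trans v≡ t))

  straight-meet : ∀ e f → e ≢ f → ∀ x → straight e x → straight f x → ∃[ v ] x ≡ position v
  straight-meet e f e≢f x x∈e x∈f
    with edges-meet _ _ (straight⇒OnEdge e x∈e) (straight⇒OnEdge f x∈f)
  ... | inj₁ same     = contradiction (same-edge e f same) e≢f
  ... | inj₂ (v , x≗) = index t v , trans (cong₂ _,_ (x≗ 0F) (x≗ 1F))
    (cong (plane ∘ place) (sym (vertex-index t v)))

  stacked-planar : Planar (stacked t)
  stacked-planar = record
    { pos           = position
    ; bends         = const []
    ; pos-injective = position-injective
    ; arc-simple    = λ e →
        (λ p≡q → Fin.<-irrefl (position-injective _ _ p≡q) (src<tgt e)) , (λ _ _ ()) , tt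
    ; vertex-on-arc = straight-vertex
    ; arcs-meet     = straight-meet
    }

mainTheorem13 : ∃[ n ] Σ[ G ∈ SimpleGraph n ] (Planar G × χ₂[ G ]≡ 20)
mainTheorem13 = order G , stacked G , stacked-planar G , stacked-χ₂
  where G = full (full leaf)
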